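{- Let $E$ be a fixed-point equation system with interpretation $[\![E]\!]\colon\mathbb{E}(D)\to\mathbb{E}(D)$, and let $\eta'\in\mathbb{E}(D)$. Then $\eta'\le\mu[\![E]\!]$ holds if there exist: (a) a fixed-point equation system $E'$ over the same quantitative predicate variables such that $[\![E']\!]\le[\![E]\!]$ (i.e. $[\![E']\!](\eta)\le[\![E]\!](\eta)$ for all $\eta\in\mathbb{E}(D)$); (b) $u\in\mathbb{E}(D)$ with $[\![E']\!](u)\le u$; (c) a function $r\colon D\to[0,\infty)$ with $(\mathsf{D}[\![E']\!])(r)+u\le r$; and (d) $\eta'\le u$ together with $\eta'\le[\![E']\!](\eta')$.
   Context: $\mathbb{E}(D)$ is the set of functions $D\to[0,\infty]$ with pointwise order and operations ($\infty+x=\infty$, $0\cdot\infty=0$, $r\cdot\infty=\infty$ for $r>0$); for $x\ge y$ in $[0,\infty]$, $x-y$ is the least $z$ with $x=y+z$; $\mathbb{O}$ is the zero function; for a map $K$ on $\mathbb{E}(D)$, $(\mathsf{D}K)(\eta)=K(\eta)-K(\mathbb{O})$; $\mu K$ is the least fixed point. Quantitative formulas over quantitative predicate variables $X_1,\dots,X_n$ (with $X_j$ of type $D_j\to\Omega$) are given by $F ::= X_j(\tilde e)\mid t\mid F_1+F_2\mid t\cdot F\mid \mathbf{if}\ \varphi\ \mathbf{then}\ F_1\ \mathbf{else}\ F_2$, where $\tilde e$ are expressions (functions of the term variables) of the argument data types, $t$ is a term taking values in $[0,\infty)$, and $\varphi$ is a boolean expression. For $\eta=(\eta_1,\dots,\eta_n)$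 and a valuation $v$ of the term variables: $[\![X_j(e)]\!](\eta)(v)=\eta_j([\![e]\!](v))$, $[\![t]\!](\eta)(v)=[\![t]\!](v)$, sums and scalar products pointwise, and the conditional by cases on $[\![\varphi]\!](v)$. A fixed-point equation system is $E=\{X_i(\tilde x_i)=_\mu F_i\}_{i=1}^n$ with $\tilde x_i$ ranging over $D_i$ and $F_i$ having free term variables among $\tilde x_i$; with $D=\coprod_j D_j$ and $\prod_j\mathbb{E}(D_j)\cong\mathbb{E}(D)$, its interpretation is $[\![E]\!](\eta)=([\![F_1]\!](\eta),\dots,[\![F_n]\!](\eta))$. -}

module Defs where

open import Data.Bool.Base using (Bool; true; false; if_then_else_)
open import Data.Empty using (⊥-elim)
open import Data.Fin.Base using (Fin)
open import Data.Integer.Base as ℤ using (-[1+_]) renaming (+_ to pos)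
import Data.Integer.Properties as ℤ
open import Data.Nat.Base as ℕ using (ℕ; zero; suc)
import Data.Nat.Properties as ℕ
open import Data.Product.Base using (Σ; ∃; ∃₂; _×_; _,_; proj₁; proj₂)
open import Data.Rational.Base as ℚ using (ℚ; 0ℚ; 1ℚ; _<_; positive; nonNegative)
import Data.Rational.Properties as ℚ
import Data.Rational.Unnormalised.Base as ℚᵘ
import Data.Rational.Unnormalised.Properties as ℚᵘ
open import Data.Rational.Solver using (module +-*-Solver)
open import Data.Sum.Base using (_⊎_; inj₁; inj₂)
open import Level using (Level; _⊔_) renaming (suc to lsuc)
open import Relation.Binary.PropositionalEquality
  using (_≡_; refl; sym; trans; cong; cong₂; subst; subst₂)
open import Relation.Nullary using (¬_; yes; no)

open +-*-Solver using (solve; _:=_; _:+_; _:*_; :-_; _:-_)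

private
  variable
    ℓ : Level
    n : ℕ

-- An element x is its open lower cut {q ∈ ℚ | q < x}; `Below q` reads
-- q < x.  The cut of 0 consists of the negative rationals and that of ∞
-- of all rationals.  This is the presentation of [0,∞] that has the
-- countable suprema needed for least fixed points constructively.

record [0,∞] : Set₁ where
  field
    Below      : ℚ → Set
    below-neg  : ∀ {q} → q < 0ℚ → Below q
    below-down : ∀ {p q} → p < q → Below q → Below p
    below-open : ∀ {q} → Below q → ∃ λ p → q < p × Below p

open [0,∞] public

infix 4 _≤_ _≈_

_≤_ : [0,∞] → [0,∞] → Set
x ≤ y = ∀ {q} → Below x q → Below y q

_≈_ : [0,∞] → [0,∞] → Set
x ≈ y = x ≤ y × y ≤ x

𝟘 : [0,∞]
𝟘 .Below q      = q < 0ℚ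
𝟘 .below-neg    = λ q<0 → q<0
𝟘 .below-down   = ℚ.<-trans
𝟘 .below-open q<0 with ℚ.<-dense q<0
... | p , q<p , p<0 = p , q<p , p<0

infixl 6 _+_
infixl 7 _·_

_+_ : [0,∞] → [0,∞] → [0,∞]
(x + y) .Below q = ∃₂ λ a b → Below x a × Below y b × q < a ℚ.+ b
(x + y) .below-neg {q} q<0 with ℚ.<-dense q<0
... | a , q<a , a<0 with ℚ.<-dense {q ℚ.- a} {0ℚ}
      (subst (q ℚ.- a <_) (ℚ.+-inverseʳ a) (ℚ.+-monoˡ-< (ℚ.- a) q<a))
...   | b , q-a<b , b<0 = a , b , below-neg x a<0 , below-neg y b<0 ,
        subst (_< a ℚ.+ b)
          (solve 2 (λ a q → a :+ (q :- a) := q) refl a q)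
          (ℚ.+-monoʳ-< a q-a<b)
(x + y) .below-down p<q (a , b , a<x , b<y , q<a+b) =
  a , b , a<x , b<y , ℚ.<-trans p<q q<a+b
(x + y) .below-open (a , b , a<x , b<y , q<a+b) with ℚ.<-dense q<a+b
... | p , q<p , p<a+b = p , q<p , a , b , a<x , b<y , p<a+b

-- The second disjunct is empty if one of the factors is 𝟘, so that
-- 𝟘 · ∞ is 𝟘, while r · ∞ is ∞ as soon as 0 < r.

_·_ : [0,∞] → [0,∞] → [0,∞]
(x · y) .Below q =
  q < 0ℚ ⊎
  ∃₂ λ a b → 0ℚ < a × 0ℚ < b × Below x a × Below y b × q < a ℚ.* b
(x · y) .below-neg = inj₁
(x · y) .below-down p<q (inj₁ q<0) = inj₁ (ℚ.<-trans p<q q<0)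
(x · y) .below-down p<q (inj₂ (a , b , 0<a , 0<b , a<x , b<y , q<ab)) =
  inj₂ (a , b , 0<a , 0<b , a<x , b<y , ℚ.<-trans p<q q<ab)
(x · y) .below-open (inj₁ q<0) with ℚ.<-dense q<0
... | p , q<p , p<0 = p , q<p , inj₁ p<0
(x · y) .below-open (inj₂ (a , b , 0<a , 0<b , a<x , b<y , q<ab))
  with ℚ.<-dense q<ab
... | p , q<p , p<ab = p , q<p , inj₂ (a , b , 0<a , 0<b , a<x , b<y , p<ab)

IsDifference : [0,∞] → [0,∞] → [0,∞] → Set₁
IsDifference x y z = x ≈ y + z × (∀ z′ → x ≈ y + z′ → z ≤ z′)

Finite : [0,∞] → Set
Finite x = ∃ λ q → ¬ Below x q

-- [0,∞): the name has ⟩ because a name cannot contain a parenthesis.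

[0,∞⟩ : Set₁
[0,∞⟩ = Σ [0,∞] Finite

𝔼 : Set ℓ → Set (ℓ ⊔ lsuc Level.zero)
𝔼 D = D → [0,∞]

infix 4 _≤ᴱ_ _≈ᴱ_
infixl 6 _+ᴱ_

_≤ᴱ_ : {D : Set ℓ} → 𝔼 D → 𝔼 D → Set ℓ
η ≤ᴱ θ = ∀ x → η x ≤ θ x

_≈ᴱ_ : {D : Set ℓ} → 𝔼 D → 𝔼 D → Set ℓ
η ≈ᴱ θ = ∀ x → η x ≈ θ x

_+ᴱ_ : {D : Set ℓ} → 𝔼 D → 𝔼 D → 𝔼 D
(η +ᴱ θ) x = η x + θ x

𝕆 : {D : Set ℓ} → 𝔼 D
𝕆 _ = 𝟘

fin : {D : Set ℓ} → (D → [0,∞⟩) → 𝔼 D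
fin r x = proj₁ (r x)

-- `IsD K η δ` says that (𝖣 K)(η) is δ.

IsD : {D : Set ℓ} → (𝔼 D → 𝔼 D) → 𝔼 D → 𝔼 D → Set (ℓ ⊔ lsuc Level.zero)
IsD K η δ = ∀ x → IsDifference (K η x) (K 𝕆 x) (δ x)

IsLeastFixedPoint : {D : Set ℓ} → (𝔼 D → 𝔼 D) → 𝔼 D →
                    Set (ℓ ⊔ lsuc Level.zero)
IsLeastFixedPoint K m = K m ≈ᴱ m × (∀ m′ → K m′ ≈ᴱ m′ → m ≤ᴱ m′)

-- `Val` is the set of valuations of the term variables; argument
-- expressions, terms and boolean expressions are functions on it.

data Formula {n : ℕ} (D : Fin n → Set ℓ) (Val : Set ℓ) :
             Set (ℓ ⊔ lsuc Level.zero) where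
  var   : (j : Fin n) (e : Val → D j) → Formula D Val
  term  : (t : Val → [0,∞⟩) → Formula D Val
  _⊕_   : (F₁ F₂ : Formula D Val) → Formula D Val
  _⊙_   : (t : Val → [0,∞⟩) (F : Formula D Val) → Formula D Val
  cond  : (φ : Val → Bool) (F₁ F₂ : Formula D Val) → Formula D Val

-- The coproduct ∐ⱼ Dⱼ; the j-th component of η ∈ 𝔼 (∐ D) is
-- λ x → η (j , x).

∐ : {n : ℕ} → (Fin n → Set ℓ) → Set ℓ
∐ D = Σ (Fin _) D

⟦_⟧ᶠ : {D : Fin n → Set ℓ} {Val : Set ℓ} →
       Formula D Val → 𝔼 (∐ D) → 𝔼 Val
⟦ var j e ⟧ᶠ      η v = η (j , e v)
⟦ term t ⟧ᶠ       η v = proj₁ (t v)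
⟦ F₁ ⊕ F₂ ⟧ᶠ      η v = ⟦ F₁ ⟧ᶠ η v + ⟦ F₂ ⟧ᶠ η v
⟦ t ⊙ F ⟧ᶠ        η v = proj₁ (t v) · ⟦ F ⟧ᶠ η v
⟦ cond φ F₁ F₂ ⟧ᶠ η v = if φ v then ⟦ F₁ ⟧ᶠ η v else ⟦ F₂ ⟧ᶠ η v

-- The free term variables of Fᵢ are among x̃ᵢ, which ranges over Dᵢ.

System : {n : ℕ} → (Fin n → Set ℓ) → Set (ℓ ⊔ lsuc Level.zero)
System D = ∀ i → Formula D (D i)

⟦_⟧ : {D : Fin n → Set ℓ} → System D → 𝔼 (∐ D) → 𝔼 (∐ D)
⟦ E ⟧ η (i , x) = ⟦ E i ⟧ᶠ η x

+-mono : ∀ {x x′ y y′} → x ≤ x′ → y ≤ y′ → x + y ≤ x′ + y′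
+-mono f g (a , b , a<x , b<y , q<) = a , b , f a<x , g b<y , q<

·-monoʳ : ∀ t {x y} → x ≤ y → t · x ≤ t · y
·-monoʳ t f (inj₁ q<0) = inj₁ q<0
·-monoʳ t f (inj₂ (a , b , 0<a , 0<b , a<t , b<x , q<)) =
  inj₂ (a , b , 0<a , 0<b , a<t , f b<x , q<)

⟦⟧ᶠ-mono : {D : Fin n → Set ℓ} {Val : Set ℓ} (F : Formula D Val)
           {η θ : 𝔼 (∐ D)} → η ≤ᴱ θ → ⟦ F ⟧ᶠ η ≤ᴱ ⟦ F ⟧ᶠ θ
⟦⟧ᶠ-mono (var j e)  η≤θ v = η≤θ (j , e v)
⟦⟧ᶠ-mono (term t)   η≤θ v = λ p → p
⟦⟧ᶠ-mono (F₁ ⊕ F₂) {η} {θ} η≤θ v =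
  +-mono {⟦ F₁ ⟧ᶠ η v} {⟦ F₁ ⟧ᶠ θ v} {⟦ F₂ ⟧ᶠ η v} {⟦ F₂ ⟧ᶠ θ v}
    (⟦⟧ᶠ-mono F₁ η≤θ v) (⟦⟧ᶠ-mono F₂ η≤θ v)
⟦⟧ᶠ-mono (t ⊙ F) {η} {θ} η≤θ v =
  ·-monoʳ (proj₁ (t v)) {⟦ F ⟧ᶠ η v} {⟦ F ⟧ᶠ θ v} (⟦⟧ᶠ-mono F η≤θ v)
⟦⟧ᶠ-mono (cond φ F₁ F₂) η≤θ v with φ v
... | true  = ⟦⟧ᶠ-mono F₁ η≤θ v
... | false = ⟦⟧ᶠ-mono F₂ η≤θ v

⟦⟧-mono : {D : Fin n → Set ℓ} (E : System D) {η θ : 𝔼 (∐ D)} →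
          η ≤ᴱ θ → ⟦ E ⟧ η ≤ᴱ ⟦ E ⟧ θ
⟦⟧-mono E η≤θ (i , x) = ⟦⟧ᶠ-mono (E i) η≤θ x

sup : (ℕ → [0,∞]) → [0,∞]
sup x .Below q = ∃ λ k → Below (x k) q
sup x .below-neg q<0 = 0 , below-neg (x 0) q<0
sup x .below-down p<q (k , q<) = k , below-down (x k) p<q q<
sup x .below-open (k , q<) with below-open (x k) q<
... | p , q<p , p< = p , q<p , k , p<

⟦⟧ᶠ-continuous :
  {D : Fin n → Set ℓ} {Val : Set ℓ} (F : Formula D Val)
  (η : ℕ → 𝔼 (∐ D)) → (∀ {k l} → k ℕ.≤ l → η k ≤ᴱ η l) →
  ⟦ F ⟧ᶠ (λ x → sup λ k → η k x) ≤ᴱ λ v → sup λ k → ⟦ F ⟧ᶠ (η k) v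
⟦⟧ᶠ-continuous (var j e)  η inc v p = p
⟦⟧ᶠ-continuous (term t)   η inc v p = 0 , p
⟦⟧ᶠ-continuous (F₁ ⊕ F₂)  η inc v (a , b , a< , b< , q<)
  with ⟦⟧ᶠ-continuous F₁ η inc v a< | ⟦⟧ᶠ-continuous F₂ η inc v b<
... | k , a<k | l , b<l =
  k ℕ.⊔ l , a , b ,
  ⟦⟧ᶠ-mono F₁ (inc (ℕ.m≤m⊔n k l)) v a<k ,
  ⟦⟧ᶠ-mono F₂ (inc (ℕ.m≤n⊔m k l)) v b<l , q<
⟦⟧ᶠ-continuous (t ⊙ F)    η inc v (inj₁ q<0) = 0 , inj₁ q<0
⟦⟧ᶠ-continuous (t ⊙ F)    η inc v (inj₂ (a , b , 0<a , 0<b , a< , b< , q<))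
  with ⟦⟧ᶠ-continuous F η inc v b<
... | k , b<k = k , inj₂ (a , b , 0<a , 0<b , a< , b<k , q<)
⟦⟧ᶠ-continuous (cond φ F₁ F₂) η inc v p with φ v
... | true  = ⟦⟧ᶠ-continuous F₁ η inc v p
... | false = ⟦⟧ᶠ-continuous F₂ η inc v p

𝟘-min : ∀ x → 𝟘 ≤ x
𝟘-min x = below-neg x

module _ {n : ℕ} {D : Fin n → Set ℓ} (E : System D) where

  private
    iter : ℕ → 𝔼 (∐ D)
    iter zero    = 𝕆
    iter (suc k) = ⟦ E ⟧ (iter k)

    iter-inc : ∀ {k l} → k ℕ.≤ l → iter k ≤ᴱ iter l
    iter-inc {l = l} ℕ.z≤n x = 𝟘-min (iter l x)
    iter-inc (ℕ.s≤s k≤l) = ⟦⟧-mono E (iter-inc k≤l)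

    iter-least : ∀ m → ⟦ E ⟧ m ≤ᴱ m → ∀ k → iter k ≤ᴱ m
    iter-least m Em≤m zero    x = 𝟘-min (m x)
    iter-least m Em≤m (suc k) x p =
      Em≤m x (⟦⟧-mono E (iter-least m Em≤m k) x p)

  μ-exists : ∃ (IsLeastFixedPoint ⟦ E ⟧)
  μ-exists = m , (λ x → below x , above x) , least
    where
    m : 𝔼 (∐ D)
    m x = sup λ k → iter k x

    below : ⟦ E ⟧ m ≤ᴱ m
    below (i , x) p with ⟦⟧ᶠ-continuous (E i) iter iter-inc x p
    ... | k , q = suc k , q

    above : m ≤ᴱ ⟦ E ⟧ m
    above x (zero  , p) = 𝟘-min (⟦ E ⟧ m x) p
    above x (suc k , p) = ⟦⟧-mono E (λ _ q → k , q) x p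

    least : ∀ m′ → ⟦ E ⟧ m′ ≈ᴱ m′ → m ≤ᴱ m′
    least m′ fix x (k , p) =
      iter-least m′ (λ y → proj₁ (fix y)) k x p

μ⟦_⟧ : {D : Fin n → Set ℓ} → System D → 𝔼 (∐ D)
μ⟦ E ⟧ = proj₁ (μ-exists E)

_×ℚ_ : ℕ → ℚ → ℚ
zero  ×ℚ ε = 0ℚ
suc k ×ℚ ε = ε ℚ.+ k ×ℚ ε

×-unit : ∀ k → k ×ℚ 1ℚ ≡ pos k ℚ./ 1
×-unit zero    = refl
×-unit (suc k) = trans (cong (1ℚ ℚ.+_) (×-unit k)) (ℚ.toℚᵘ-injective
  (ℚᵘ.≃-trans (ℚ.toℚᵘ-homo-+ 1ℚ (pos k ℚ./ 1))
  (ℚᵘ.≃-trans (ℚᵘ.+-congʳ (ℚ.toℚᵘ 1ℚ) (ℚ.toℚᵘ-fromℚᵘ (ℚᵘ.mkℚᵘ (pos k) 0)))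
  (ℚᵘ.≃-trans
    (ℚᵘ.*≡* (cong (ℤ._* pos 1) (cong (ℤ._+_ (pos 1)) (ℤ.*-identityʳ (pos k)))))
    (ℚᵘ.≃-sym (ℚ.toℚᵘ-fromℚᵘ (ℚᵘ.mkℚᵘ (pos (suc k)) 0)))))))

×-scale : ∀ k ε → (k ×ℚ 1ℚ) ℚ.* ε ≡ k ×ℚ ε
×-scale zero    ε = ℚ.*-zeroˡ ε
×-scale (suc k) ε = trans
  (ℚ.*-distribʳ-+ ε 1ℚ (k ×ℚ 1ℚ))
  (cong₂ ℚ._+_ (ℚ.*-identityˡ ε) (×-scale k ε))

≤-natural : ∀ p → ∃ λ k → p ℚ.≤ pos k ℚ./ 1
≤-natural p@(ℚ.mkℚ i d _) = ℤ.∣ i ∣ , ℚ.toℚᵘ-cancel-≤ {p}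
  (ℚᵘ.≤-trans {j = ℚᵘ.mkℚᵘ (pos ℤ.∣ i ∣) 0} (ℚᵘ.*≤* (bound i d))
    (ℚᵘ.≤-reflexive
      (ℚᵘ.≃-sym (ℚ.toℚᵘ-fromℚᵘ (ℚᵘ.mkℚᵘ (pos ℤ.∣ i ∣) 0)))))
  where
  bound : ∀ i d → i ℤ.* pos 1 ℤ.≤ pos ℤ.∣ i ∣ ℤ.* pos (suc d)
  bound (pos m) d = subst₂ ℤ._≤_ (ℤ.pos-* m 1) (ℤ.pos-* m (suc d))
    (ℤ.+≤+ (ℕ.*-monoʳ-≤ m (ℕ.s≤s ℕ.z≤n)))
  bound -[1+ m ] d = ℤ.-≤+

archimedean : ∀ p {ε} → 0ℚ < ε → ∃ λ k → p ℚ.≤ k ×ℚ ε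
archimedean p {ε} 0<ε = k ,
  subst₂ ℚ._≤_
    (trans (ℚ.*-assoc p (ℚ.1/ ε) ε)
      (trans (cong (p ℚ.*_) (ℚ.*-inverseˡ ε)) (ℚ.*-identityʳ p)))
    (trans (cong (ℚ._* ε) (sym (×-unit k))) (×-scale k ε))
    (ℚ.*-monoʳ-≤-nonNeg ε (proj₂ (≤-natural (p ℚ.* ℚ.1/ ε))))
  where
  instance
    ε≥0 : ℚ.NonNegative ε
    ε≥0 = nonNegative (ℚ.<⇒≤ 0<ε)
    ε≢0 : ℚ.NonZero ε
    ε≢0 = ℚ.pos⇒nonZero ε {{positive 0<ε}}
  k : ℕ
  k = proj₁ (≤-natural (p ℚ.* ℚ.1/ ε))

diff-pos : ∀ {p q} → p < q → 0ℚ < q ℚ.- p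
diff-pos {p} {q} p<q =
  subst (_< q ℚ.- p) (ℚ.+-inverseʳ p) (ℚ.+-monoˡ-< (ℚ.- p) p<q)

below-≤ : ∀ x {p q} → p ℚ.≤ q → Below x q → Below x p
below-≤ x p≤q q<x with below-open x q<x
... | r , q<r , r<x = below-down x (ℚ.≤-<-trans p≤q q<r) r<x

neg-+-cancel : ∀ u B → ℚ.- u ℚ.+ (u ℚ.+ B) ≡ B
neg-+-cancel = solve 2 (λ u B → (:- u) :+ (u :+ B) := B) refl

-- If b + w ≤ b + z then b is unbounded or every q < w satisfies q < z:
-- for q < q′ < w, either q < z or b is closed under adding q′ - q.

climb : ∀ b {w z q q′} → b + w ≤ b + z → Below w q′ →
        ∀ k → Below z q ⊎ Below b (ℚ.- 1ℚ ℚ.+ k ×ℚ (q′ ℚ.- q))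
climb b f q′<w zero = inj₂ (below-neg b (ℚ.negative⁻¹ _))
climb b {w} {z} {q} {q′} f q′<w (suc k) with climb b {w} {z} f q′<w k
... | inj₁ q<z = inj₁ q<z
... | inj₂ s<b
  with below-open b s<b
...   | s′ , s<s′ , s′<b
    with f {(ℚ.- 1ℚ ℚ.+ k ×ℚ (q′ ℚ.- q)) ℚ.+ q′}
           (s′ , q′ , s′<b , q′<w , ℚ.+-monoˡ-< q′ s<s′)
...     | a , c , a<b , c<z , s+q′<a+c with q ℚ.≤? c
...       | yes q≤c = inj₁ (below-≤ z q≤c c<z)
...       | no  q≰c = inj₂ (below-down b
              (subst₂ _<_
                (solve 4 (λ u m q q′ → (u :+ m :+ q′) :- q :=
                                       u :+ ((q′ :- q) :+ m))
                       refl (ℚ.- 1ℚ) (k ×ℚ (q′ ℚ.- q)) q q′)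
                (solve 2 (λ a q → (a :+ q) :- q := a) refl a q)
                (ℚ.+-monoˡ-< (ℚ.- q)
                  (ℚ.<-trans s+q′<a+c (ℚ.+-monoʳ-< a (ℚ.≰⇒> q≰c)))))
              a<b)

+-cancel : ∀ b {w z} → Finite b → b + w ≤ b + z → w ≤ z
+-cancel b {w} {z} (B , B≮b) f {q} q<w with below-open w q<w
... | q′ , q<q′ , q′<w = bounded (archimedean (1ℚ ℚ.+ B) (diff-pos q<q′))
  where
  ε : ℚ
  ε = q′ ℚ.- q

  bounded : (∃ λ k → 1ℚ ℚ.+ B ℚ.≤ k ×ℚ ε) → Below z q
  bounded (k , 1+B≤) with climb b {w} {z} {q} {q′} f q′<w k
  ... | inj₁ q<z = q<z
  ... | inj₂ s<b = ⊥-elim (B≮b (below-≤ b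
          (subst (ℚ._≤ ℚ.- 1ℚ ℚ.+ k ×ℚ ε) (neg-+-cancel 1ℚ B)
            (ℚ.+-monoʳ-≤ (ℚ.- 1ℚ) 1+B≤))
          s<b))

difference : ∀ {x y z} → Finite y → x ≈ y + z → IsDifference x y z
difference {x} {y} {z} fin-y x≈y+z = x≈y+z , λ z′ x≈y+z′ →
  +-cancel y {z} {z′} fin-y (λ p → proj₁ x≈y+z′ (proj₂ x≈y+z p))

≤-+ˡ : ∀ x y → x ≤ x + y
≤-+ˡ x y {q} q<x with below-open x q<x
... | p , q<p , p<x with ℚ.<-dense (diff-pos q<p)
...   | e , 0<e , e<p-q = p , ℚ.- e , p<x ,
        below-neg y (ℚ.neg-antimono-< 0<e) ,
        subst (_< p ℚ.- e)
          (solve 2 (λ p q → p :- (p :- q) := q) refl p q)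
          (ℚ.+-monoʳ-< p (ℚ.neg-antimono-< e<p-q))

+-swap : ∀ x y → x + y ≤ y + x
+-swap x y {q} (a , b , a<x , b<y , q<) =
  b , a , b<y , a<x , subst (q <_) (ℚ.+-comm a b) q<

+-below : ∀ x y {a b} → Below x a → Below y b → Below (x + y) (a ℚ.+ b)
+-below x y a<x b<y with below-open x a<x | below-open y b<y
... | a′ , a<a′ , a′<x | b′ , b<b′ , b′<y =
  a′ , b′ , a′<x , b′<y , ℚ.+-mono-< a<a′ b<b′

+-interchange : ∀ x₁ y₁ x₂ y₂ →
  (x₁ + y₁) + (x₂ + y₂) ≤ (x₁ + x₂) + (y₁ + y₂)
+-interchange x₁ y₁ x₂ y₂ {q}
  (_ , _ , (a , b , a< , b< , s<) , (c , d , c< , d< , t<) , q<) =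
  a ℚ.+ c , b ℚ.+ d , +-below x₁ x₂ a< c< , +-below y₁ y₂ b< d< ,
  subst (q <_)
    (solve 4 (λ a b c d → (a :+ b) :+ (c :+ d) := (a :+ c) :+ (b :+ d))
      refl a b c d)
    (ℚ.<-trans q< (ℚ.+-mono-< s< t<))

*-monoʳ-< : ∀ {a b c} → 0ℚ < a → b < c → a ℚ.* b < a ℚ.* c
*-monoʳ-< {a} 0<a = ℚ.*-monoʳ-<-pos a {{positive 0<a}}

·-below : ∀ t x {a e} → 0ℚ < a → Below t a → Below x e →
          Below (t · x) (a ℚ.* e)
·-below t x {a} {e} 0<a a<t e<x with below-open x e<x
... | e′ , e<e′ , e′<x with 0ℚ ℚ.<? e′
...   | yes 0<e′ =
        inj₂ (a , e′ , 0<a , 0<e′ , a<t , e′<x , *-monoʳ-< 0<a e<e′)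
...   | no  0≮e′ = inj₁ (subst (a ℚ.* e <_) (ℚ.*-zeroʳ a)
        (*-monoʳ-< 0<a (ℚ.<-≤-trans e<e′ (ℚ.≮⇒≥ 0≮e′))))

·-distrib-≤ : ∀ t x y → t · (x + y) ≤ t · x + t · y
·-distrib-≤ t x y (inj₁ q<0) = below-neg (t · x + t · y) q<0
·-distrib-≤ t x y {q}
  (inj₂ (a , c , 0<a , 0<c , a<t , (e , f , e<x , f<y , c<) , q<)) =
  a ℚ.* e , a ℚ.* f , ·-below t x 0<a a<t e<x , ·-below t y 0<a a<t f<y ,
  subst (q <_) (ℚ.*-distribˡ-+ a e f) (ℚ.<-trans q< (*-monoʳ-< 0<a c<))

*-monoˡ-≤ : ∀ {a b c} → 0ℚ < c → a ℚ.≤ b → a ℚ.* c ℚ.≤ b ℚ.* c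
*-monoˡ-≤ {c = c} 0<c =
  ℚ.*-monoʳ-≤-nonNeg c {{nonNegative (ℚ.<⇒≤ 0<c)}}

drop-neg : ∀ {q A B} → q < A ℚ.+ B → A < 0ℚ → q < B
drop-neg {q} {A} {B} q< A<0 = ℚ.<-trans q<
  (subst (A ℚ.+ B <_) (ℚ.+-identityˡ B) (ℚ.+-monoˡ-< B A<0))

neg-+ : ∀ {q A B C} → q < A ℚ.+ B → A < 0ℚ → B < C → q < C
neg-+ q< A<0 B<C = ℚ.<-trans (drop-neg q< A<0) B<C

·-distrib-≥ : ∀ t x y → t · x + t · y ≤ t · (x + y)
·-distrib-≥ t x y (A , B , inj₁ A<0 , inj₁ B<0 , q<) =
  inj₁ (neg-+ q< A<0 B<0)
·-distrib-≥ t x y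
  (A , B , inj₁ A<0 , inj₂ (b , f , 0<b , 0<f , b<t , f<y , B<) , q<) =
  inj₂ (b , f , 0<b , 0<f , b<t , +-swap y x (≤-+ˡ y x f<y) ,
    neg-+ q< A<0 B<)
·-distrib-≥ t x y {q}
  (A , B , inj₂ (a , e , 0<a , 0<e , a<t , e<x , A<) , inj₁ B<0 , q<) =
  inj₂ (a , e , 0<a , 0<e , a<t , ≤-+ˡ x y e<x ,
    neg-+ (subst (q <_) (ℚ.+-comm A B) q<) B<0 A<)
·-distrib-≥ t x y {q}
  (A , B , inj₂ (a , e , 0<a , 0<e , a<t , e<x , A<) ,
           inj₂ (b , f , 0<b , 0<f , b<t , f<y , B<) , q<)
  with ℚ.≤-total a b
... | inj₁ a≤b = inj₂ (b , e ℚ.+ f , 0<b , ℚ.+-mono-< 0<e 0<f , b<t ,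
        +-below x y e<x f<y ,
        subst (q <_) (sym (ℚ.*-distribˡ-+ b e f))
          (ℚ.<-≤-trans (ℚ.<-trans q< (ℚ.+-mono-< A< B<))
            (ℚ.+-monoˡ-≤ (b ℚ.* f) (*-monoˡ-≤ 0<e a≤b))))
... | inj₂ b≤a = inj₂ (a , e ℚ.+ f , 0<a , ℚ.+-mono-< 0<e 0<f , a<t ,
        +-below x y e<x f<y ,
        subst (q <_) (sym (ℚ.*-distribˡ-+ a e f))
          (ℚ.<-≤-trans (ℚ.<-trans q< (ℚ.+-mono-< A< B<))
            (ℚ.+-monoʳ-≤ (a ℚ.* e) (*-monoˡ-≤ 0<f b≤a))))

+-finite : ∀ x y → Finite x → Finite y → Finite (x + y)
+-finite x y (p , p≮x) (q , q≮y) = p ℚ.+ q ,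
  λ { (a , b , a<x , b<y , p+q<) → ℚ.<-irrefl refl (ℚ.<-trans p+q<
      (ℚ.+-mono-< (≮⇒> x p≮x a<x) (≮⇒> y q≮y b<y))) }
  where
  ≮⇒> : ∀ z {r s} → ¬ Below z r → Below z s → s < r
  ≮⇒> z r≮z s<z = ℚ.≰⇒> λ r≤s → r≮z (below-≤ z r≤s s<z)

·-finite : ∀ x y → Finite x → Finite y → Finite (x · y)
·-finite x y (p , p≮x) (q , q≮y) = p ℚ.* q ,
  λ { (inj₁ pq<0) → ℚ.<-irrefl refl (ℚ.<-≤-trans pq<0
        (subst (ℚ._≤ p ℚ.* q) (ℚ.*-zeroˡ q)
          (ℚ.*-monoʳ-≤-nonNeg q {{nonNegative (0≤ y q≮y)}} (0≤ x p≮x))))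
    ; (inj₂ (a , b , 0<a , 0<b , a<x , b<y , pq<)) →
        ℚ.<-irrefl refl (ℚ.<-≤-trans pq< (ℚ.≤-trans
          (*-monoˡ-≤ 0<b (≮⇒≥ x p≮x a<x))
          (ℚ.*-monoˡ-≤-nonNeg p {{nonNegative (0≤ x p≮x)}}
            (≮⇒≥ y q≮y b<y)))) }
  where
  0≤ : ∀ z {r} → ¬ Below z r → 0ℚ ℚ.≤ r
  0≤ z r≮z = ℚ.≮⇒≥ λ r<0 → r≮z (below-neg z r<0)
  ≮⇒≥ : ∀ z {r s} → ¬ Below z r → Below z s → s ℚ.≤ r
  ≮⇒≥ z r≮z s<z = ℚ.≮⇒≥ λ r<s → r≮z (below-down z r<s s<z)

⟦⟧ᶠ-finite : {D : Fin n → Set ℓ} {Val : Set ℓ} (F : Formula D Val) →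
             ∀ v → Finite (⟦ F ⟧ᶠ 𝕆 v)
⟦⟧ᶠ-finite (var j e) v = 0ℚ , ℚ.<-irrefl refl
⟦⟧ᶠ-finite (term t) v = proj₂ (t v)
⟦⟧ᶠ-finite (F₁ ⊕ F₂) v =
  +-finite (⟦ F₁ ⟧ᶠ 𝕆 v) (⟦ F₂ ⟧ᶠ 𝕆 v) (⟦⟧ᶠ-finite F₁ v) (⟦⟧ᶠ-finite F₂ v)
⟦⟧ᶠ-finite (t ⊙ F) v =
  ·-finite (proj₁ (t v)) (⟦ F ⟧ᶠ 𝕆 v) (proj₂ (t v)) (⟦⟧ᶠ-finite F v)
⟦⟧ᶠ-finite (cond φ F₁ F₂) v with φ v
... | true  = ⟦⟧ᶠ-finite F₁ v
... | false = ⟦⟧ᶠ-finite F₂ v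

-- The map η ↦ ⟦ F ⟧ᶠ η without its constant terms; ⟦⟧ᶠ-affine and
-- ⟦⟧ᶠ-finite identify it with 𝖣 of that map.

⟦_⟧ᴸ : {D : Fin n → Set ℓ} {Val : Set ℓ} →
       Formula D Val → 𝔼 (∐ D) → 𝔼 Val
⟦ var j e ⟧ᴸ      η v = η (j , e v)
⟦ term t ⟧ᴸ       η v = 𝟘
⟦ F₁ ⊕ F₂ ⟧ᴸ      η v = ⟦ F₁ ⟧ᴸ η v + ⟦ F₂ ⟧ᴸ η v
⟦ t ⊙ F ⟧ᴸ        η v = proj₁ (t v) · ⟦ F ⟧ᴸ η v
⟦ cond φ F₁ F₂ ⟧ᴸ η v = if φ v then ⟦ F₁ ⟧ᴸ η v else ⟦ F₂ ⟧ᴸ η v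

⟦⟧ᶠ-affine : {D : Fin n → Set ℓ} {Val : Set ℓ} (F : Formula D Val)
             (η : 𝔼 (∐ D)) → ⟦ F ⟧ᶠ η ≈ᴱ ⟦ F ⟧ᶠ 𝕆 +ᴱ ⟦ F ⟧ᴸ η
⟦⟧ᶠ-affine (var j e) η v =
  (λ p → +-swap x 𝟘 (≤-+ˡ x 𝟘 p)) ,
  (λ { (a , b , a<0 , b<x , q<) → below-down x (drop-neg q< a<0) b<x })
  where
  x : [0,∞]
  x = η (j , e v)
⟦⟧ᶠ-affine (term t) η v =
  ≤-+ˡ x 𝟘 ,
  (λ { {q} (a , b , a<x , b<0 , q<) →
       below-down x (drop-neg (subst (q <_) (ℚ.+-comm a b) q<) b<0) a<x })
  where
  x : [0,∞]
  x = proj₁ (t v)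
⟦⟧ᶠ-affine (F₁ ⊕ F₂) η v
  with ⟦⟧ᶠ-affine F₁ η v | ⟦⟧ᶠ-affine F₂ η v
... | f₁ , g₁ | f₂ , g₂ =
  (λ p → +-interchange b₁ l₁ b₂ l₂
    (+-mono {x₁} {b₁ + l₁} {x₂} {b₂ + l₂} f₁ f₂ p)) ,
  (λ p → +-mono {b₁ + l₁} {x₁} {b₂ + l₂} {x₂} g₁ g₂
    (+-interchange b₁ b₂ l₁ l₂ p))
  where
  x₁ b₁ l₁ x₂ b₂ l₂ : [0,∞]
  x₁ = ⟦ F₁ ⟧ᶠ η v
  b₁ = ⟦ F₁ ⟧ᶠ 𝕆 v
  l₁ = ⟦ F₁ ⟧ᴸ η v
  x₂ = ⟦ F₂ ⟧ᶠ η v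
  b₂ = ⟦ F₂ ⟧ᶠ 𝕆 v
  l₂ = ⟦ F₂ ⟧ᴸ η v
⟦⟧ᶠ-affine (t ⊙ F) η v with ⟦⟧ᶠ-affine F η v
... | f , g =
  (λ p → ·-distrib-≤ s b l (·-monoʳ s {x} {b + l} f p)) ,
  (λ p → ·-monoʳ s {b + l} {x} g (·-distrib-≥ s b l p))
  where
  s x b l : [0,∞]
  s = proj₁ (t v)
  x = ⟦ F ⟧ᶠ η v
  b = ⟦ F ⟧ᶠ 𝕆 v
  l = ⟦ F ⟧ᴸ η v
⟦⟧ᶠ-affine (cond φ F₁ F₂) η v with φ v
... | true  = ⟦⟧ᶠ-affine F₁ η v
... | false = ⟦⟧ᶠ-affine F₂ η v

𝖣-exists : {D : Fin n → Set ℓ} (E : System D) (η : 𝔼 (∐ D)) →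
           ∃ (IsD ⟦ E ⟧ η)
𝖣-exists E η = (λ { (i , x) → ⟦ E i ⟧ᴸ η x }) , λ { (i , x) →
  difference {⟦ E i ⟧ᶠ η x} {⟦ E i ⟧ᶠ 𝕆 x} {⟦ E i ⟧ᴸ η x}
    (⟦⟧ᶠ-finite (E i) x) (⟦⟧ᶠ-affine (E i) η x) }

𝖣⟦_⟧ : {D : Fin n → Set ℓ} → System D → 𝔼 (∐ D) → 𝔼 (∐ D)
𝖣⟦ E ⟧ η = proj₁ (𝖣-exists E η)

{-# OPTIONS --safe #-}
-- Write K for ⟦ E′ ⟧, L for 𝖣⟦ E′ ⟧ and m for μ⟦ E ⟧, so that K m ≤ m.  As K is
-- affine with linear part L, η′ ≤ K η′ and η′ ≤ u give η′ ≤ m + Lᵏ u for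
-- all k.  From L u ≤ K u ≤ u the powers Lᵏ u are bounded by u, and
-- L r + u ≤ r then yields k times Lᵏ u ≤ r by induction on k.  Since r is
-- finite, Lᵏ u tends to 0 pointwise, whence η′ ≤ m.
module Submission where

open import Defs
open import Level using (Level)
open import Data.Nat.Base using (ℕ; zero; suc)
open import Data.Fin.Base using (Fin)
open import Data.Bool.Base using (true; false)
open import Data.Empty using (⊥-elim)
open import Data.Product.Base using (∃; _×_; _,_; proj₁; proj₂)
open import Data.Rational.Base as ℚ using (ℚ; 0ℚ; 1ℚ; _<_)
import Data.Rational.Properties as ℚ
open import Data.Rational.Solver using (module +-*-Solver)
open import Relation.Binary.PropositionalEquality using (_≡_; refl; subst; subst₂)
open import Relation.Nullary using (yes; no)

open +-*-Solver using (solve; _:=_; _:+_; _:-_)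

private
  variable
    ℓ : Level
    n : ℕ
    D : Fin n → Set ℓ
    Val : Set ℓ

+-minus : ∀ b c → (b ℚ.+ c) ℚ.- b ≡ c
+-minus = solve 2 (λ b c → (b :+ c) :- b := c) refl

plus-minus : ∀ b q → b ℚ.+ (q ℚ.- b) ≡ q
plus-minus = solve 2 (λ b q → b :+ (q :- b) := q) refl

+-minusʳ : ∀ a c → (a ℚ.+ c) ℚ.- c ≡ a
+-minusʳ = solve 2 (λ a c → (a :+ c) :- c := a) refl

minus-minus : ∀ p q → p ℚ.- (p ℚ.- q) ≡ q
minus-minus = solve 2 (λ p q → p :- (p :- q) := q) refl

infixr 7 _⋆_

_⋆_ : ℕ → [0,∞] → [0,∞]
zero  ⋆ x = 𝟘
suc k ⋆ x = x + k ⋆ x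

⋆-below : ∀ x k {q b} → q < k ×ℚ b → Below x b → Below (k ⋆ x) q
⋆-below x zero q<0 b<x = q<0
⋆-below x (suc k) {q} {b} q<b+kb b<x = split (ℚ.<-dense q-b<kb)
  where
  q-b<kb : q ℚ.- b < k ×ℚ b
  q-b<kb = subst (q ℚ.- b <_) (+-minus b (k ×ℚ b)) (ℚ.+-monoˡ-< (ℚ.- b) q<b+kb)

  -- Density supplies the second summand `p`: the cut of a sum needs `q < b + p` strictly, and the
  -- remaining `k` copies need `p < k ×ℚ b`.
  split : (∃ λ p → q ℚ.- b < p × p < k ×ℚ b) → Below (suc k ⋆ x) q
  split (p , q-b<p , p<kb) = b , p , b<x , ⋆-below x k p<kb b<x ,
    subst (_< b ℚ.+ p) (plus-minus b q) (ℚ.+-monoʳ-< b q-b<p)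

-- An Archimedean argument. Given `q < p < x`, the index `k` is fixed from `p - q` and the bound `R`
-- of `r` before the cut of `m + y k` is opened into `a` and `b`. If `b` is at most `p - q`, then
-- `q < a`; otherwise `k` copies of `p - q` exceed `R`, which puts `R` below `r`.
⋆-bounded⇒≤ : ∀ {x m r} (y : ℕ → [0,∞]) → Finite r →
              (∀ k → x ≤ m + y k) → (∀ k → k ⋆ y k ≤ r) → x ≤ m
⋆-bounded⇒≤ {x} {m} {r} y (R , R≮r) x≤m+y ky≤r {q} q<x
  with below-open x q<x
... | p , q<p , p<x = limit (archimedean (1ℚ ℚ.+ R) (diff-pos q<p))
  where
  ε : ℚ
  ε = p ℚ.- q

  -- `archimedean` gives a weak inequality while `⋆-below` takes a strict one; aiming at `1ℚ + R`
  -- closes the gap.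
  R<1+R : R < 1ℚ ℚ.+ R
  R<1+R = subst (_< 1ℚ ℚ.+ R) (ℚ.+-identityˡ R)
    (ℚ.+-monoˡ-< R (ℚ.positive⁻¹ 1ℚ))

  limit : (∃ λ k → 1ℚ ℚ.+ R ℚ.≤ k ×ℚ ε) → Below m q
  limit (k , 1+R≤kε) with x≤m+y k p<x
  ... | a , b , a<m , b<y , p<a+b with b ℚ.≤? ε
  ...   | yes b≤ε = below-down m
          (subst₂ _<_ (minus-minus p q) (+-minusʳ a ε)
            (ℚ.+-monoˡ-< (ℚ.- ε) (ℚ.<-≤-trans p<a+b (ℚ.+-monoʳ-≤ a b≤ε))))
          a<m
  ...   | no  b≰ε = ⊥-elim (R≮r (ky≤r k
          (⋆-below (y k) k (ℚ.<-≤-trans R<1+R 1+R≤kε)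
            (below-down (y k) (ℚ.≰⇒> b≰ε) b<y))))

⟦⟧ᴸ-mono : (F : Formula D Val) {η θ : 𝔼 (∐ D)} →
           η ≤ᴱ θ → ⟦ F ⟧ᴸ η ≤ᴱ ⟦ F ⟧ᴸ θ
⟦⟧ᴸ-mono (var j e) η≤θ v = η≤θ (j , e v)
⟦⟧ᴸ-mono (term t)  η≤θ v = λ p → p
⟦⟧ᴸ-mono (F₁ ⊕ F₂) {η} {θ} η≤θ v =
  +-mono {⟦ F₁ ⟧ᴸ η v} {⟦ F₁ ⟧ᴸ θ v} {⟦ F₂ ⟧ᴸ η v} {⟦ F₂ ⟧ᴸ θ v}
    (⟦⟧ᴸ-mono F₁ η≤θ v) (⟦⟧ᴸ-mono F₂ η≤θ v)
⟦⟧ᴸ-mono (t ⊙ F) {η} {θ} η≤θ v =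
  ·-monoʳ (proj₁ (t v)) {⟦ F ⟧ᴸ η v} {⟦ F ⟧ᴸ θ v} (⟦⟧ᴸ-mono F η≤θ v)
⟦⟧ᴸ-mono (cond φ F₁ F₂) η≤θ v with φ v
... | true  = ⟦⟧ᴸ-mono F₁ η≤θ v
... | false = ⟦⟧ᴸ-mono F₂ η≤θ v

-- Constants are replaced by `𝟘` in the linear part, so the `term` case is only `𝟘 + 𝟘 ≤ 𝟘`.
-- Iterated, this moves a multiple `k ⋆_` inside `𝖣⟦ E ⟧`.
⟦⟧ᴸ-superadditive : (F : Formula D Val) (η θ : 𝔼 (∐ D)) →
                    ⟦ F ⟧ᴸ η +ᴱ ⟦ F ⟧ᴸ θ ≤ᴱ ⟦ F ⟧ᴸ (η +ᴱ θ)
⟦⟧ᴸ-superadditive (var j e) η θ v = λ p → p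
⟦⟧ᴸ-superadditive (term t)  η θ v (a , b , a<0 , b<0 , q<) = neg-+ q< a<0 b<0
⟦⟧ᴸ-superadditive (F₁ ⊕ F₂) η θ v p =
  +-mono {x₁ + y₁} {⟦ F₁ ⟧ᴸ (η +ᴱ θ) v} {x₂ + y₂} {⟦ F₂ ⟧ᴸ (η +ᴱ θ) v}
    (⟦⟧ᴸ-superadditive F₁ η θ v) (⟦⟧ᴸ-superadditive F₂ η θ v)
    (+-interchange x₁ x₂ y₁ y₂ p)
  where
  x₁ x₂ y₁ y₂ : [0,∞]
  x₁ = ⟦ F₁ ⟧ᴸ η v
  x₂ = ⟦ F₂ ⟧ᴸ η v
  y₁ = ⟦ F₁ ⟧ᴸ θ v
  y₂ = ⟦ F₂ ⟧ᴸ θ v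
⟦⟧ᴸ-superadditive (t ⊙ F) η θ v p =
  ·-monoʳ (proj₁ (t v)) {⟦ F ⟧ᴸ η v + ⟦ F ⟧ᴸ θ v} {⟦ F ⟧ᴸ (η +ᴱ θ) v}
    (⟦⟧ᴸ-superadditive F η θ v)
    (·-distrib-≥ (proj₁ (t v)) (⟦ F ⟧ᴸ η v) (⟦ F ⟧ᴸ θ v) p)
⟦⟧ᴸ-superadditive (cond φ F₁ F₂) η θ v with φ v
... | true  = ⟦⟧ᴸ-superadditive F₁ η θ v
... | false = ⟦⟧ᴸ-superadditive F₂ η θ v

-- All constants go to the summand at `η`, so the increment `θ` enters only linearly. This is one
-- direction of `⟦⟧ᶠ-affine` with the base point moved from `𝕆` to `η`.
⟦⟧ᶠ-+-≤ : (F : Formula D Val) (η θ : 𝔼 (∐ D)) →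
          ⟦ F ⟧ᶠ (η +ᴱ θ) ≤ᴱ ⟦ F ⟧ᶠ η +ᴱ ⟦ F ⟧ᴸ θ
⟦⟧ᶠ-+-≤ (var j e) η θ v = λ p → p
⟦⟧ᶠ-+-≤ (term t)  η θ v = ≤-+ˡ (proj₁ (t v)) 𝟘
⟦⟧ᶠ-+-≤ (F₁ ⊕ F₂) η θ v p =
  +-interchange x₁ y₁ x₂ y₂
    (+-mono {⟦ F₁ ⟧ᶠ (η +ᴱ θ) v} {x₁ + y₁} {⟦ F₂ ⟧ᶠ (η +ᴱ θ) v} {x₂ + y₂}
      (⟦⟧ᶠ-+-≤ F₁ η θ v) (⟦⟧ᶠ-+-≤ F₂ η θ v) p)
  where
  x₁ x₂ y₁ y₂ : [0,∞]
  x₁ = ⟦ F₁ ⟧ᶠ η v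
  x₂ = ⟦ F₂ ⟧ᶠ η v
  y₁ = ⟦ F₁ ⟧ᴸ θ v
  y₂ = ⟦ F₂ ⟧ᴸ θ v
⟦⟧ᶠ-+-≤ (t ⊙ F) η θ v p =
  ·-distrib-≤ (proj₁ (t v)) (⟦ F ⟧ᶠ η v) (⟦ F ⟧ᴸ θ v)
    (·-monoʳ (proj₁ (t v)) {⟦ F ⟧ᶠ (η +ᴱ θ) v} {⟦ F ⟧ᶠ η v + ⟦ F ⟧ᴸ θ v}
      (⟦⟧ᶠ-+-≤ F η θ v) p)
⟦⟧ᶠ-+-≤ (cond φ F₁ F₂) η θ v with φ v
... | true  = ⟦⟧ᶠ-+-≤ F₁ η θ v
... | false = ⟦⟧ᶠ-+-≤ F₂ η θ v

𝖣-mono : (E : System D) {η θ : 𝔼 (∐ D)} → η ≤ᴱ θ → 𝖣⟦ E ⟧ η ≤ᴱ 𝖣⟦ E ⟧ θ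
𝖣-mono E η≤θ (i , x) = ⟦⟧ᴸ-mono (E i) η≤θ x

-- By affinity, the right side is the left side plus the constant part `⟦ E ⟧ 𝕆`.
𝖣-≤ : (E : System D) (η : 𝔼 (∐ D)) → 𝖣⟦ E ⟧ η ≤ᴱ ⟦ E ⟧ η
𝖣-≤ E η (i , x) p =
  proj₂ (⟦⟧ᶠ-affine (E i) η x) (+-swap l b (≤-+ˡ l b p))
  where
  l b : [0,∞]
  l = ⟦ E i ⟧ᴸ η x
  b = ⟦ E i ⟧ᶠ 𝕆 x

⋆-𝖣-≤ : (E : System D) (η : 𝔼 (∐ D)) (k : ℕ) →
        (λ x → k ⋆ 𝖣⟦ E ⟧ η x) ≤ᴱ 𝖣⟦ E ⟧ (λ x → k ⋆ η x)
⋆-𝖣-≤ E η zero    x = 𝟘-min (𝖣⟦ E ⟧ 𝕆 x)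
⋆-𝖣-≤ E η (suc k) x@(i , v) p =
  ⟦⟧ᴸ-superadditive (E i) η (λ y → k ⋆ η y) v
    (+-mono {𝖣⟦ E ⟧ η x} {𝖣⟦ E ⟧ η x} {k ⋆ 𝖣⟦ E ⟧ η x}
      {𝖣⟦ E ⟧ (λ y → k ⋆ η y) x} (λ z → z) (⋆-𝖣-≤ E η k x) p)

theorem4p1 : {ℓ : Level} {n : ℕ} {D : Fin n → Set ℓ} (E : System D) (η′ : 𝔼 (∐ D)) →
    (E′ : System D) → (∀ (η : 𝔼 (∐ D)) → ⟦ E′ ⟧ η ≤ᴱ ⟦ E ⟧ η) →
    (u : 𝔼 (∐ D)) → ⟦ E′ ⟧ u ≤ᴱ u →
    (r : ∐ D → [0,∞⟩) → 𝖣⟦ E′ ⟧ (fin r) +ᴱ u ≤ᴱ fin r →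
    η′ ≤ᴱ u → η′ ≤ᴱ ⟦ E′ ⟧ η′ →
    η′ ≤ᴱ μ⟦ E ⟧
theorem4p1 {D = D} E η′ E′ E′≤E u E′u≤u r Lr+u≤r η′≤u η′≤E′η′ x =
  ⋆-bounded⇒≤ {η′ x} {m x} {fin r x} (λ k → L^ k x) (proj₂ (r x))
    (λ k → η′≤m+L^ k x) (λ k → ⋆-L^≤r k x)
  where
  m : 𝔼 (∐ D)
  m = μ⟦ E ⟧

  L^ : ℕ → 𝔼 (∐ D)
  L^ zero    = u
  L^ (suc k) = 𝖣⟦ E′ ⟧ (L^ k)

  E′m≤m : ⟦ E′ ⟧ m ≤ᴱ m
  E′m≤m y p = proj₁ (proj₁ (proj₂ (μ-exists E)) y) (E′≤E m y p)

  L^≤u : ∀ k → L^ k ≤ᴱ u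
  L^≤u zero    y p = p
  L^≤u (suc k) y p = E′u≤u y (𝖣-≤ E′ u y (𝖣-mono E′ (L^≤u k) y p))

  η′≤m+L^ : ∀ k → η′ ≤ᴱ m +ᴱ L^ k
  η′≤m+L^ zero    y p = +-swap (u y) (m y) (≤-+ˡ (u y) (m y) (η′≤u y p))
  η′≤m+L^ (suc k) y@(i , v) p =
    -- The chain is `η′ ≤ K η′ ≤ K (m + Lᵏ u) ≤ K m + Lᵏ⁺¹ u ≤ m + Lᵏ⁺¹ u`.
    +-mono {⟦ E′ ⟧ m y} {m y} {L^ (suc k) y} {L^ (suc k) y}
      (E′m≤m y) (λ z → z)
      (⟦⟧ᶠ-+-≤ (E′ i) m (L^ k) v
        (⟦⟧-mono E′ (η′≤m+L^ k) y (η′≤E′η′ y p)))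

  ⋆-L^≤r : ∀ k → (λ y → k ⋆ L^ k y) ≤ᴱ fin r
  ⋆-L^≤r zero    y = 𝟘-min (fin r y)
  -- Of the `k + 1` copies of `Lᵏ⁺¹ u`, one is bounded by `u`. The other `k` become `L` of `k`
  -- copies of `Lᵏ u`, hence at most `L r` by induction; this is why multiplicity and exponent grow
  -- together.
  ⋆-L^≤r (suc k) y p = Lr+u≤r y
    (+-swap (u y) (𝖣⟦ E′ ⟧ (fin r) y)
      (+-mono {L^ (suc k) y} {u y} {k ⋆ L^ (suc k) y} {𝖣⟦ E′ ⟧ (fin r) y}
        (L^≤u (suc k) y)
        (λ z → 𝖣-mono E′ (⋆-L^≤r k) y (⋆-𝖣-≤ E′ (L^ k) k y z))
        p))
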